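{- Let $f:(0,\infty)\times(0,\infty)\to\mathbb{R}$ be a function with $f(x,y)>0$ for all $x,y>0$. Suppose that $f$ is homogeneous, i.e. $f(kx,ky)=f(x,y)$ for all $k>0$ and all $x,y>0$, and that $f$ is integrable in $x$, i.e. $x\mapsto f(x,1)$ is Riemann integrable on $[0,1]$. Put $c=\int_0^1 f(x,1)\,dx$. Then, as $N\to\infty$ through the positive integers, $$\sum_{n\le N} f(n,N)\log n\sim cN\log N,$$ where the sum runs over integers $1\le n\le N$.
   Context: The notation $A(N)\sim B(N)$ means $A(N)/B(N)\to 1$ as $N\to\infty$. The value assigned to $f(0,1)$ is immaterial; Riemann integrability on $[0,1]$ is understood for the function $x\mapsto f(x,1)$ extended by any value at $x=0$. -}

module Defs where

open import Level using (0ℓ)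
open import Algebra.Bundles using (CommutativeRing)
open import Data.Nat.Base as ℕ using (ℕ; zero; suc; NonZero)
open import Data.Product.Base using (Σ; ∃; _×_; _,_; proj₁; proj₂)
open import Data.Sum.Base using (inj₁; inj₂)
open import Data.Unit.Base using (⊤; tt)
open import Function.Base using (_on_)
open import Relation.Binary.Core using (Rel)
open import Relation.Binary.Definitions using (tri<; tri≈; tri>)
open import Relation.Binary.Structures using (IsStrictTotalOrder; IsTotalOrder)
open import Relation.Nullary.Decidable.Core using (Dec; yes; no)
open import Relation.Nullary.Negation.Core using (contradiction)
import Algebra.Properties.Ring as RingProperties
import Algebra.Properties.Semiring.Mult as SemiringMult
import Algebra.Properties.Semiring.Sum as SemiringSum
import Relation.Binary.Construct.StrictToNonStrict as StrictToNonStrict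
import Relation.Binary.Reasoning.Setoid as SetoidReasoning

-- The real numbers are given by their usual axioms: a totally ordered field
-- in which every nonempty subset that is bounded above has a least upper
-- bound.  These axioms determine ℝ up to isomorphism, so a theorem about every
-- such structure is a theorem about ℝ.
record CompleteOrderedField : Set₁ where
  infix 4 _<_
  field
    commutativeRing : CommutativeRing 0ℓ 0ℓ

  open CommutativeRing commutativeRing public

  field
    _<_                : Rel Carrier 0ℓ
    isStrictTotalOrder : IsStrictTotalOrder _≈_ _<_
    +-monoʳ-<          : ∀ z {x y} → x < y → z + x < z + y
    *-pos              : ∀ {x y} → 0# < x → 0# < y → 0# < x * y
    0<1                : 0# < 1#
    inverse            : ∀ x → x ≉ 0# → ∃ λ y → x * y ≈ 1#

  open StrictToNonStrict _≈_ _<_ public using (_≤_)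

  IsUpperBound : (Carrier → Set) → Carrier → Set
  IsUpperBound S u = ∀ x → S x → x ≤ u

  IsSupremum : (Carrier → Set) → Carrier → Set
  IsSupremum S s = IsUpperBound S s × (∀ u → IsUpperBound S u → s ≤ u)

  field
    supremum : (S : Carrier → Set) → ∃ S → ∃ (IsUpperBound S) → ∃ (IsSupremum S)

module Real (ℝ : CompleteOrderedField) where

  open CompleteOrderedField ℝ public
  open IsStrictTotalOrder isStrictTotalOrder public
    using (compare; _≟_; _<?_; <-resp-≈; <-respʳ-≈; <-respˡ-≈)
    renaming (trans to <-trans; irrefl to <-irrefl; asym to <-asym)
  open IsTotalOrder (StrictToNonStrict.isTotalOrder _≈_ _<_ isStrictTotalOrder) public
    using (≤-respʳ-≈; ≤-respˡ-≈)
    renaming (refl to ≤-refl; trans to ≤-trans; total to ≤-total)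
  open SemiringSum semiring public using (sum)
  open SemiringMult semiring using () renaming (_×_ to _·_)
  open RingProperties ring using ([y-z]x≈yx-zx; -‿distribʳ-*)

  infixl 7 _/_
  infix  4 _≈⁺_ _∼_
  infixl 7 _*⁺_

  -- Division is total, with x / 0 = 0.
  reciprocal : ∀ x → Dec (x ≈ 0#) → Carrier
  reciprocal x (yes _)  = 0#
  reciprocal x (no x≉0) = proj₁ (inverse x x≉0)

  1/_ : Carrier → Carrier
  1/ x = reciprocal x (x ≟ 0#)

  _/_ : Carrier → Carrier → Carrier
  x / y = x * 1/ y

  ∣_∣ : Carrier → Carrier
  ∣ x ∣ with compare x 0#
  ... | tri< _ _ _ = - x
  ... | tri≈ _ _ _ = x
  ... | tri> _ _ _ = x

  -- The interval (0,∞).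
  ℝ⁺ : Set
  ℝ⁺ = Σ Carrier (0# <_)

  _≈⁺_ : Rel ℝ⁺ 0ℓ
  _≈⁺_ = _≈_ on proj₁

  _*⁺_ : ℝ⁺ → ℝ⁺ → ℝ⁺
  (x , 0<x) *⁺ (y , 0<y) = x * y , *-pos 0<x 0<y

  1⁺ : ℝ⁺
  1⁺ = 1# , 0<1

  fromℕ : ℕ → Carrier
  fromℕ n = n · 1#

  0<fromℕ-suc : ∀ n → 0# < fromℕ (suc n)
  0<fromℕ-suc zero    = <-respʳ-≈ (sym (+-identityʳ 1#)) 0<1
  0<fromℕ-suc (suc n) = <-trans 0<1
    (<-respˡ-≈ (+-identityʳ 1#) (+-monoʳ-< 1# (0<fromℕ-suc n)))

  fromℕ⁺ : (n : ℕ) → .{{NonZero n}} → ℝ⁺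
  fromℕ⁺ (suc n) = fromℕ (suc n) , 0<fromℕ-suc n

  -- Limits and asymptotic equality along the positive integers.

  Sequence : Set
  Sequence = (N : ℕ) → .{{NonZero N}} → Carrier

  _TendsTo_ : Sequence → Carrier → Set
  a TendsTo l = ∀ ε → 0# < ε →
    ∃ λ M → ∀ N → .{{_ : NonZero N}} → M ℕ.≤ N → ∣ a N - l ∣ < ε

  -- Since x / 0 = 0, this forces B N to be nonzero for all large N.
  _∼_ : Sequence → Sequence → Set
  A ∼ B = (λ N → A N / B N) TendsTo 1#

  -- Partitions a = x₀ ≤ x₁ ≤ … ≤ xₙ = b, with a tag in each [xᵢ₋₁ , xᵢ].

  infixl 5 _▹_

  data Partition (a : Carrier) : Carrier → Set where
    []  : Partition a a
    _▹_ : ∀ {x y} → Partition a x → x ≤ y → Partition a y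

  Tagging : ∀ {a b} → Partition a b → Set
  Tagging []              = ⊤
  Tagging (_▹_ {x} {y} P _) = Tagging P × ∃ λ t → x ≤ t × t ≤ y

  MeshBelow : ∀ {a b} → Carrier → Partition a b → Set
  MeshBelow δ []                = ⊤
  MeshBelow δ (_▹_ {x} {y} P _) = MeshBelow δ P × y - x < δ

  riemannSum : ∀ {a b} → (Carrier → Carrier) → (P : Partition a b) → Tagging P → Carrier
  riemannSum g []                _             = 0#
  riemannSum g (_▹_ {x} {y} P _) (τ , t , _) = riemannSum g P τ + g t * (y - x)

  -- g is applied only to points of [a , b].
  IsRiemannIntegral : (Carrier → Carrier) → (a b I : Carrier) → Set
  IsRiemannIntegral g a b I = ∀ ε → 0# < ε → ∃ λ δ → 0# < δ ×
    (∀ (P : Partition a b) (τ : Tagging P) → MeshBelow δ P → ∣ riemannSum g P τ - I ∣ < ε)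

  RiemannIntegrable : (Carrier → Carrier) → (a b : Carrier) → Set
  RiemannIntegrable g a b = ∃ (IsRiemannIntegral g a b)

  ∫ : ∀ g a b → RiemannIntegrable g a b → Carrier
  ∫ g a b = proj₁

  -- The function on [0 , ∞) equal to h on (0 , ∞) and to v at 0.
  extendBy : Carrier → (ℝ⁺ → Carrier) → Carrier → Carrier
  extendBy v h x with 0# <? x
  ... | yes 0<x = h (x , 0<x)
  ... | no _    = v

  -- The natural logarithm is log x = ∫₁ˣ dt/t, read as - ∫ₓ¹ dt/t for x < 1.
  -- Since 1/t is decreasing, the lower Darboux sums are the Riemann sums
  -- tagged at right endpoints, and the integral is their supremum over all
  -- partitions.

  rightTags : ∀ {a b} (P : Partition a b) → Tagging P
  rightTags []                = tt
  rightTags (_▹_ {x} {y} P x≤y) = rightTags P , y , x≤y , ≤-refl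

  LowerSum1/t : (a b : Carrier) → Carrier → Set
  LowerSum1/t a b s = ∃ λ (P : Partition a b) → s ≈ riemannSum 1/_ P (rightTags P)

  +-mono-≤ : ∀ {x y u v} → x ≤ y → u ≤ v → x + u ≤ y + v
  +-mono-≤ {x} {y} {u} {v} x≤y u≤v =
    ≤-trans (right x u≤v) (≤-respʳ-≈ (+-comm v y) (≤-respˡ-≈ (+-comm v x) (right v x≤y)))
    where
    right : ∀ z {p q} → p ≤ q → z + p ≤ z + q
    right z (inj₁ p<q) = inj₁ (+-monoʳ-< z p<q)
    right z (inj₂ p≈q) = inj₂ (+-congˡ p≈q)

  x≤y⇒0≤y-x : ∀ {x y} → x ≤ y → 0# ≤ y - x
  x≤y⇒0≤y-x {x} x≤y = ≤-respˡ-≈ (-‿inverseʳ x) (+-mono-≤ x≤y ≤-refl)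

  0≤y-x⇒x≤y : ∀ {x y} → 0# ≤ y - x → x ≤ y
  0≤y-x⇒x≤y {x} {y} p =
    ≤-respˡ-≈ (+-identityˡ x) (≤-respʳ-≈ cancel (+-mono-≤ p ≤-refl))
    where
    cancel : y - x + x ≈ y
    cancel = trans (+-assoc y (- x) x) (trans (+-congˡ (-‿inverseˡ x)) (+-identityʳ y))

  0≤* : ∀ {x y} → 0# ≤ x → 0# ≤ y → 0# ≤ x * y
  0≤* (inj₁ 0<x) (inj₁ 0<y) = inj₁ (*-pos 0<x 0<y)
  0≤* {x} {y} (inj₂ 0≈x) _  = inj₂ (trans (sym (zeroˡ y)) (*-congʳ 0≈x))
  0≤* {x} {y} _ (inj₂ 0≈y)  = inj₂ (trans (sym (zeroʳ x)) (*-congˡ 0≈y))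

  *-monoʳ-≤ : ∀ {x y z} → 0# ≤ z → x ≤ y → x * z ≤ y * z
  *-monoʳ-≤ {x} {y} {z} 0≤z x≤y =
    0≤y-x⇒x≤y (≤-respʳ-≈ ([y-z]x≈yx-zx z y x) (0≤* (x≤y⇒0≤y-x x≤y) 0≤z))

  0<⇒≉0 : ∀ {x} → 0# < x → x ≉ 0#
  0<⇒≉0 0<x x≈0 = <-irrefl (sym x≈0) 0<x

  x*1/x≈1 : ∀ {x} → x ≉ 0# → x * 1/ x ≈ 1#
  x*1/x≈1 {x} x≉0 with x ≟ 0#
  ... | yes x≈0  = contradiction x≈0 x≉0
  ... | no  x≉0′ = proj₂ (inverse x x≉0′)

  0<1/x : ∀ {x} → 0# < x → 0# < 1/ x
  0<1/x {x} 0<x with compare 0# (1/ x)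
  ... | tri< 0<r _ _ = 0<r
  ... | tri≈ _ 0≈r _ = contradiction
    (trans (sym (zeroʳ x)) (trans (*-congˡ 0≈r) (x*1/x≈1 (0<⇒≉0 0<x)))) λ 0≈1 → <-irrefl 0≈1 0<1
  ... | tri> _ _ r<0 = contradiction 1<0 (<-asym 0<1)
    where
    0<-r : 0# < - (1/ x)
    0<-r = <-respˡ-≈ (-‿inverseˡ _) (<-respʳ-≈ (+-identityʳ _) (+-monoʳ-< (- (1/ x)) r<0))
    0<-1 : 0# < - 1#
    0<-1 = <-respʳ-≈ (trans (sym (-‿distribʳ-* x (1/ x)))
                            (-‿cong (x*1/x≈1 (0<⇒≉0 0<x))))
                     (*-pos 0<x 0<-r)
    1<0 : 1# < 0#
    1<0 = <-respˡ-≈ (+-identityʳ 1#) (<-respʳ-≈ (-‿inverseʳ 1#) (+-monoʳ-< 1# 0<-1))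

  1/-anti-≤ : ∀ {x y} → 0# < x → 0# < y → x ≤ y → 1/ y ≤ 1/ x
  1/-anti-≤ {x} {y} 0<x 0<y x≤y =
    ≤-respˡ-≈ left (≤-respʳ-≈ right (*-monoʳ-≤ (inj₁ (*-pos (0<1/x 0<x) (0<1/x 0<y))) x≤y))
    where
    open SetoidReasoning setoid
    left : x * (1/ x * 1/ y) ≈ 1/ y
    left = begin
      x * (1/ x * 1/ y) ≈⟨ *-assoc x (1/ x) (1/ y) ⟨
      x * 1/ x * 1/ y   ≈⟨ *-congʳ (x*1/x≈1 (0<⇒≉0 0<x)) ⟩
      1# * 1/ y         ≈⟨ *-identityˡ (1/ y) ⟩
      1/ y              ∎
    right : y * (1/ x * 1/ y) ≈ 1/ x
    right = begin
      y * (1/ x * 1/ y) ≈⟨ *-congˡ (*-comm (1/ x) (1/ y)) ⟩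
      y * (1/ y * 1/ x) ≈⟨ *-assoc y (1/ y) (1/ x) ⟨
      y * 1/ y * 1/ x   ≈⟨ *-congʳ (x*1/x≈1 (0<⇒≉0 0<y)) ⟩
      1# * 1/ x         ≈⟨ *-identityˡ (1/ x) ⟩
      1/ x              ∎

  a≤end : ∀ {a b} → Partition a b → a ≤ b
  a≤end []        = ≤-refl
  a≤end (P ▹ x≤y) = ≤-trans (a≤end P) x≤y

  0<-≤-trans : ∀ {x y} → 0# < x → x ≤ y → 0# < y
  0<-≤-trans 0<x (inj₁ x<y) = <-trans 0<x x<y
  0<-≤-trans 0<x (inj₂ x≈y) = <-respʳ-≈ x≈y 0<x

  lowerSum-bound : ∀ {a b} → 0# < a → (P : Partition a b) →
                   riemannSum 1/_ P (rightTags P) ≤ 1/ a * (b - a)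
  lowerSum-bound {a} 0<a [] = inj₂ (sym (trans (*-congˡ (-‿inverseʳ a)) (zeroʳ (1/ a))))
  lowerSum-bound {a} 0<a (_▹_ {x} {y} P x≤y) =
    ≤-respʳ-≈ telescope (+-mono-≤ (lowerSum-bound 0<a P)
      (*-monoʳ-≤ (x≤y⇒0≤y-x x≤y) (1/-anti-≤ 0<a (0<-≤-trans 0<a a≤y) a≤y)))
    where
    open SetoidReasoning setoid
    a≤y : a ≤ y
    a≤y = ≤-trans (a≤end P) x≤y
    telescope : 1/ a * (x - a) + 1/ a * (y - x) ≈ 1/ a * (y - a)
    telescope = begin
      1/ a * (x - a) + 1/ a * (y - x) ≈⟨ distribˡ (1/ a) (x - a) (y - x) ⟨
      1/ a * (x - a + (y - x))        ≈⟨ *-congˡ (+-comm (x - a) (y - x)) ⟩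
      1/ a * (y - x + (x - a))        ≈⟨ *-congˡ (+-assoc y (- x) (x - a)) ⟩
      1/ a * (y + (- x + (x - a)))    ≈⟨ *-congˡ (+-congˡ (+-assoc (- x) x (- a))) ⟨
      1/ a * (y + (- x + x - a))      ≈⟨ *-congˡ (+-congˡ (+-congʳ (-‿inverseˡ x))) ⟩
      1/ a * (y + (0# - a))           ≈⟨ *-congˡ (+-congˡ (+-identityˡ (- a))) ⟩
      1/ a * (y - a)                  ∎

  ∫1/t-supremum : ∀ a b → 0# < a → a ≤ b → ∃ (IsSupremum (LowerSum1/t a b))
  ∫1/t-supremum a b 0<a a≤b = supremum (LowerSum1/t a b)
    (_ , [] ▹ a≤b , refl)
    (1/ a * (b - a) , λ s (P , s≈) → ≤-respˡ-≈ (sym s≈) (lowerSum-bound 0<a P))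

  ∫1/t : ∀ a b → 0# < a → a ≤ b → Carrier
  ∫1/t a b 0<a a≤b = proj₁ (∫1/t-supremum a b 0<a a≤b)

  log : ℝ⁺ → Carrier
  log (x , 0<x) with ≤-total 1# x
  ... | inj₁ 1≤x = ∫1/t 1# x 0<1 1≤x
  ... | inj₂ x≤1 = - ∫1/t x 1# 0<x x≤1

{-# OPTIONS --safe #-}
module Submission where

-- Put g x = f (x, 1), so that f (n, N) = g (n / N) by homogeneity.  Then the
-- (1/N) Σ g (n / N) are Riemann sums for c, and replacing log n by log N costs
--   Σ g (n / N) (log N - log n) ≤ M (N log N - log N!) ≤ M N,
-- where M bounds g on (0 , 1]; this is o(N log N).  Dividing by
-- c N log N requires c > 0.  Otherwise every interval [x , y] ⊆ (0 , 1] would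
-- contain, for each ε > 0, a subinterval on which g < ε, and a point common to a
-- nested sequence of these with ε = 1, 1/2, 1/3, … would have g ≤ 0.

open import Level using (0ℓ)
open import Axiom.ExcludedMiddle using (ExcludedMiddle)
open import Data.Fin.Base using (Fin; toℕ)
open import Data.Nat.Base using (ℕ; suc)
open import Data.Product.Base using (proj₁)
open import Relation.Binary.Core using (_Preserves₂_⟶_⟶_)
open import Defs

open import Algebra.Bundles using (CommutativeRing; RawRing)
import Algebra.Properties.AbelianGroup as AbelianGroupProperties
import Algebra.Properties.CommutativeSemigroup as CommutativeSemigroupProperties
import Algebra.Properties.Ring as RingProperties
import Algebra.Properties.Semiring.Mult as SemiringMult
import Algebra.Properties.Semiring.Mult.TCOptimised as OptimisedMult
import Algebra.Solver.Ring as RingSolver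
open import Algebra.Solver.Ring.AlmostCommutativeRing
  using (fromCommutativeRing; _-Raw-AlmostCommutative⟶_)
open import Data.Integer.Base as ℤ using (ℤ; +_; -[1+_]; _⊖_)
import Data.Integer.Properties as ℤ
open import Data.Maybe.Base using (just; nothing)
open import Data.Nat.Base as ℕ using (zero; z≤n; s≤s)
import Data.Nat.Properties as ℕ
open import Data.Product.Base using (∃; _×_; _,_; proj₂)
open import Data.Sum.Base using (_⊎_; inj₁; inj₂)
open import Data.Unit.Base using (tt)
open import Relation.Binary.Definitions using (tri<; tri≈; tri>; WeaklyDecidable)
open import Relation.Binary.PropositionalEquality.Core as ≡ using (_≡_)
import Relation.Binary.Reasoning.Setoid as SetoidReasoning
open import Relation.Nullary.Decidable.Core using (yes; no)
open import Relation.Nullary.Negation.Core using (¬_; contradiction)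

-- The library's ring solver decides identities in an abstract commutative ring
-- only once coefficients with a computing equality, here ℤ, are supplied.
module IntegerCoefficientSolver (R : CommutativeRing 0ℓ 0ℓ) where

  open CommutativeRing R
  open OptimisedMult semiring using (×-homo-+; ×1-homo-*; 1+×) renaming (_×_ to _·_)
  open RingProperties ring
  open AbelianGroupProperties +-abelianGroup using (⁻¹-∙-comm; ε⁻¹≈ε; ⁻¹-involutive)
  open CommutativeSemigroupProperties +-commutativeSemigroup using (interchange)
  open SetoidReasoning setoid

  -- Splitting an integer as `pos` minus `neg` makes every coefficient operation a single difference
  -- of naturals, so the homomorphism laws need no case analysis on signs.
  pos neg : ℤ → ℕ
  pos (+ n)    = n
  pos -[1+ n ] = 0
  neg (+ n)    = 0
  neg -[1+ n ] = suc n

  coefficients : RawRing 0ℓ 0ℓ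
  coefficients = record
    { Carrier = ℤ
    ; _≈_     = _≡_
    ; _+_     = λ i j → (pos i ℕ.+ pos j) ⊖ (neg i ℕ.+ neg j)
    ; _*_     = λ i j → (pos i ℕ.* pos j ℕ.+ neg i ℕ.* neg j)
                      ⊖ (pos i ℕ.* neg j ℕ.+ neg i ℕ.* pos j)
    ; -_      = λ i → neg i ⊖ pos i
    ; 0#      = + 0
    ; 1#      = + 1
    }

  -- With the optimised multiple, `1 · 1#` computes to `1#`, so `con (+ 1)` in a solver call denotes
  -- `1#` itself.
  ⟦_⟧ : ℤ → Carrier
  ⟦ + n ⟧      = n · 1#
  ⟦ -[1+ n ] ⟧ = - (suc n · 1#)

  x-0≈x : ∀ x → x - 0# ≈ x
  x-0≈x x = trans (+-congˡ ε⁻¹≈ε) (+-identityʳ x)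

  ⟦⟧-split : ∀ i → ⟦ i ⟧ ≈ pos i · 1# - neg i · 1#
  ⟦⟧-split (+ n)    = sym (x-0≈x (n · 1#))
  ⟦⟧-split -[1+ n ] = sym (+-identityˡ _)

  -‿interchange : ∀ a b c d → (a - b) + (c - d) ≈ (a + c) - (b + d)
  -‿interchange a b c d = trans (interchange a (- b) c (- d)) (+-congˡ (⁻¹-∙-comm b d))

  ⟦⊖⟧ : ∀ m n → ⟦ m ⊖ n ⟧ ≈ m · 1# - n · 1#
  ⟦⊖⟧ zero    zero    = sym (-‿inverseʳ 0#)
  ⟦⊖⟧ zero    (suc n) = sym (+-identityˡ _)
  ⟦⊖⟧ (suc m) zero    = sym (x-0≈x _)
  ⟦⊖⟧ (suc m) (suc n) = begin
    ⟦ suc m ⊖ suc n ⟧                 ≡⟨ ≡.cong ⟦_⟧ (ℤ.[1+m]⊖[1+n]≡m⊖n m n) ⟩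
    ⟦ m ⊖ n ⟧                         ≈⟨ ⟦⊖⟧ m n ⟩
    m · 1# - n · 1#                   ≈⟨ +-identityˡ _ ⟨
    0# + (m · 1# - n · 1#)            ≈⟨ +-congʳ (-‿inverseʳ 1#) ⟨
    (1# - 1#) + (m · 1# - n · 1#)     ≈⟨ -‿interchange _ _ _ _ ⟩
    (1# + m · 1#) - (1# + n · 1#)     ≈⟨ +-cong (1+× m 1#) (-‿cong (1+× n 1#)) ⟨
    suc m · 1# - suc n · 1#           ∎

  product-of-differences : ∀ a b c d → (a - b) * (c - d) ≈ (a * c + b * d) - (a * d + b * c)
  product-of-differences a b c d = begin
    (a - b) * (c - d)                     ≈⟨ [y-z]x≈yx-zx (c - d) a b ⟩
    a * (c - d) - b * (c - d)             ≈⟨ +-cong (x[y-z]≈xy-xz a c d) (-‿cong (x[y-z]≈xy-xz b c d)) ⟩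
    (a * c - a * d) - (b * c - b * d)     ≈⟨ +-congˡ (⁻¹-∙-comm (b * c) (- (b * d))) ⟨
    (a * c - a * d) + (- (b * c) - - (b * d)) ≈⟨ +-congˡ (+-comm _ _) ⟩
    (a * c - a * d) + (- - (b * d) - b * c) ≈⟨ +-congˡ (+-congʳ (⁻¹-involutive _)) ⟩
    (a * c - a * d) + (b * d - b * c)     ≈⟨ -‿interchange _ _ _ _ ⟩
    (a * c + b * d) - (a * d + b * c)     ∎

  morphism : coefficients -Raw-AlmostCommutative⟶ fromCommutativeRing R
  morphism = record
    { ⟦_⟧    = ⟦_⟧
    ; +-homo = λ i j → begin
        ⟦ (pos i ℕ.+ pos j) ⊖ (neg i ℕ.+ neg j) ⟧
          ≈⟨ ⟦⊖⟧ (pos i ℕ.+ pos j) (neg i ℕ.+ neg j) ⟩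
        (pos i ℕ.+ pos j) · 1# - (neg i ℕ.+ neg j) · 1#
          ≈⟨ +-cong (×-homo-+ 1# (pos i) (pos j)) (-‿cong (×-homo-+ 1# (neg i) (neg j))) ⟩
        (pos i · 1# + pos j · 1#) - (neg i · 1# + neg j · 1#)
          ≈⟨ -‿interchange _ _ _ _ ⟨
        (pos i · 1# - neg i · 1#) + (pos j · 1# - neg j · 1#)
          ≈⟨ +-cong (⟦⟧-split i) (⟦⟧-split j) ⟨
        ⟦ i ⟧ + ⟦ j ⟧ ∎
    ; *-homo = λ i j → begin
        ⟦ (pos i ℕ.* pos j ℕ.+ neg i ℕ.* neg j) ⊖ (pos i ℕ.* neg j ℕ.+ neg i ℕ.* pos j) ⟧
          ≈⟨ ⟦⊖⟧ (pos i ℕ.* pos j ℕ.+ neg i ℕ.* neg j) (pos i ℕ.* neg j ℕ.+ neg i ℕ.* pos j) ⟩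
        (pos i ℕ.* pos j ℕ.+ neg i ℕ.* neg j) · 1# - (pos i ℕ.* neg j ℕ.+ neg i ℕ.* pos j) · 1#
          ≈⟨ +-cong (sum-of-products (pos i) (pos j) (neg i) (neg j))
                    (-‿cong (sum-of-products (pos i) (neg j) (neg i) (pos j))) ⟩
        (pos i · 1# * (pos j · 1#) + neg i · 1# * (neg j · 1#)) -
        (pos i · 1# * (neg j · 1#) + neg i · 1# * (pos j · 1#))
          ≈⟨ product-of-differences _ _ _ _ ⟨
        (pos i · 1# - neg i · 1#) * (pos j · 1# - neg j · 1#)
          ≈⟨ *-cong (⟦⟧-split i) (⟦⟧-split j) ⟨
        ⟦ i ⟧ * ⟦ j ⟧ ∎
    ; -‿homo = λ i → begin
        ⟦ neg i ⊖ pos i ⟧             ≈⟨ ⟦⊖⟧ (neg i) (pos i) ⟩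
        neg i · 1# - pos i · 1#       ≈⟨ +-comm _ _ ⟩
        - (pos i · 1#) + neg i · 1#   ≈⟨ +-congˡ (⁻¹-involutive _) ⟨
        - (pos i · 1#) - - (neg i · 1#) ≈⟨ ⁻¹-∙-comm _ _ ⟩
        - (pos i · 1# - neg i · 1#)   ≈⟨ -‿cong (⟦⟧-split i) ⟨
        - ⟦ i ⟧ ∎
    ; 0-homo = refl
    ; 1-homo = refl
    }
    where
    sum-of-products : ∀ k l m n → (k ℕ.* l ℕ.+ m ℕ.* n) · 1# ≈ k · 1# * (l · 1#) + m · 1# * (n · 1#)
    sum-of-products k l m n =
      trans (×-homo-+ 1# (k ℕ.* l) (m ℕ.* n)) (+-cong (×1-homo-* k l) (×1-homo-* m n))

  _coeff≟_ : WeaklyDecidable (λ i j → ⟦ i ⟧ ≈ ⟦ j ⟧)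
  i coeff≟ j with i ℤ.≟ j
  ... | yes i≡j = just (reflexive (≡.cong ⟦_⟧ i≡j))
  ... | no _    = nothing

  open RingSolver coefficients (fromCommutativeRing R) morphism _coeff≟_ public
    using (solve; _:=_; _:+_; _:*_; _:-_; :-_; con)

module RealAnalysis (em : ExcludedMiddle 0ℓ) (ℝ : CompleteOrderedField) where

  open Real ℝ
  open SemiringMult semiring using (×-assoc-*; ×-congʳ; ×-homo-+) renaming (_×_ to _·_)
  open IntegerCoefficientSolver commutativeRing
    using (solve; _:=_; _:+_; _:*_; _:-_; :-_; con)

  -- Inequalities between reals.

  ≤-antisym : ∀ {x y} → x ≤ y → y ≤ x → x ≈ y
  ≤-antisym (inj₂ x≈y) _          = x≈y
  ≤-antisym (inj₁ _)   (inj₂ y≈x) = sym y≈x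
  ≤-antisym (inj₁ x<y) (inj₁ y<x) = contradiction y<x (<-asym x<y)

  <-≤-trans : ∀ {x y z} → x < y → y ≤ z → x < z
  <-≤-trans x<y (inj₁ y<z) = <-trans x<y y<z
  <-≤-trans x<y (inj₂ y≈z) = <-respʳ-≈ y≈z x<y

  ≤-<-trans : ∀ {x y z} → x ≤ y → y < z → x < z
  ≤-<-trans (inj₁ x<y) y<z = <-trans x<y y<z
  ≤-<-trans (inj₂ x≈y) y<z = <-respˡ-≈ (sym x≈y) y<z

  ≤⇒≯ : ∀ {x y} → x ≤ y → ¬ y < x
  ≤⇒≯ x≤y y<x = <-irrefl refl (≤-<-trans x≤y y<x)

  ≤⊎> : ∀ x y → x ≤ y ⊎ y < x
  ≤⊎> x y with compare x y
  ... | tri< x<y _ _ = inj₁ (inj₁ x<y)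
  ... | tri≈ _ x≈y _ = inj₁ (inj₂ x≈y)
  ... | tri> _ _ y<x = inj₂ y<x

  ≮⇒≥ : ∀ {x y} → ¬ x < y → y ≤ x
  ≮⇒≥ {x} {y} x≮y with ≤⊎> y x
  ... | inj₁ y≤x = y≤x
  ... | inj₂ x<y = contradiction x<y x≮y

  x<y⇒0<y-x : ∀ {x y} → x < y → 0# < y - x
  x<y⇒0<y-x {x} {y} x<y =
    <-respˡ-≈ (-‿inverseˡ x) (<-respʳ-≈ (+-comm (- x) y) (+-monoʳ-< (- x) x<y))

  0<y-x⇒x<y : ∀ {x y} → 0# < y - x → x < y
  0<y-x⇒x<y {x} {y} p =
    <-respˡ-≈ (+-identityʳ x) (<-respʳ-≈ (solve 2 (λ x y → x :+ (y :- x) := y) refl x y) (+-monoʳ-< x p))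

  ≤-by : ∀ {x y d} → y - x ≈ d → 0# ≤ d → x ≤ y
  ≤-by y-x≈d 0≤d = 0≤y-x⇒x≤y (≤-respʳ-≈ (sym y-x≈d) 0≤d)

  <-by : ∀ {x y d} → y - x ≈ d → 0# < d → x < y
  <-by y-x≈d 0<d = 0<y-x⇒x<y (<-respʳ-≈ (sym y-x≈d) 0<d)

  0≤+ : ∀ {x y} → 0# ≤ x → 0# ≤ y → 0# ≤ x + y
  0≤+ 0≤x 0≤y = ≤-respˡ-≈ (+-identityʳ 0#) (+-mono-≤ 0≤x 0≤y)

  0<+0≤ : ∀ {x y} → 0# < x → 0# ≤ y → 0# < x + y
  0<+0≤ {x} {y} 0<x 0≤y =
    <-≤-trans 0<x (≤-by (solve 2 (λ x y → x :+ y :- x := y) refl x y) 0≤y)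

  *-monoˡ-≤ : ∀ {x y z} → 0# ≤ z → x ≤ y → z * x ≤ z * y
  *-monoˡ-≤ {x} {y} {z} 0≤z x≤y =
    ≤-by (solve 3 (λ x y z → z :* y :- z :* x := z :* (y :- x)) refl x y z) (0≤* 0≤z (x≤y⇒0≤y-x x≤y))

  *-monoˡ-< : ∀ {x y z} → 0# < z → x < y → z * x < z * y
  *-monoˡ-< {x} {y} {z} 0<z x<y =
    <-by (solve 3 (λ x y z → z :* y :- z :* x := z :* (y :- x)) refl x y z) (*-pos 0<z (x<y⇒0<y-x x<y))

  0≤∣x∣ : ∀ x → 0# ≤ ∣ x ∣
  0≤∣x∣ x with compare x 0#
  ... | tri< x<0 _ _ = inj₁ (<-respʳ-≈ (+-identityˡ _) (x<y⇒0<y-x x<0))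
  ... | tri≈ _ x≈0 _ = inj₂ (sym x≈0)
  ... | tri> _ _ 0<x = inj₁ 0<x

  ∣x∣<ε⇒x<ε : ∀ {x ε} → ∣ x ∣ < ε → x < ε
  ∣x∣<ε⇒x<ε {x} p with compare x 0#
  ... | tri< x<0 _ _ = <-trans x<0 (<-trans (<-respʳ-≈ (+-identityˡ _) (x<y⇒0<y-x x<0)) p)
  ... | tri≈ _ _ _   = p
  ... | tri> _ _ _   = p

  ∣x∣<ε⇒-x<ε : ∀ {x ε} → ∣ x ∣ < ε → - x < ε
  ∣x∣<ε⇒-x<ε {x} p with compare x 0#
  ... | tri< _ _ _   = p
  ... | tri≈ _ x≈0 _ = <-respˡ-≈ (trans x≈0 (trans (solve 0 (con (+ 0) := :- con (+ 0)) refl) (-‿cong (sym x≈0)))) p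
  ... | tri> _ _ 0<x = <-trans (<-by (solve 1 (λ x → con (+ 0) :- (:- x) := x) refl x) 0<x) (<-trans 0<x p)

  x<ε∧-x<ε⇒∣x∣<ε : ∀ {x ε} → x < ε → - x < ε → ∣ x ∣ < ε
  x<ε∧-x<ε⇒∣x∣<ε {x} p q with compare x 0#
  ... | tri< _ _ _ = q
  ... | tri≈ _ _ _ = p
  ... | tri> _ _ _ = p

  1/x*x≈1 : ∀ {x} → 0# < x → 1/ x * x ≈ 1#
  1/x*x≈1 {x} 0<x = trans (*-comm (1/ x) x) (x*1/x≈1 (0<⇒≉0 0<x))

  -- Consequences of completeness.

  private
    Range : (ℕ → Carrier) → Carrier → Set
    Range a x = ∃ λ n → x ≈ a n

  -- If `x` bounded all terms, the range would have a supremum `s`. Every `a n + d` lies below some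
  -- term, hence below `s`, so `s - d` would be a smaller upper bound.
  unbounded : ∀ (a : ℕ → Carrier) {d} → 0# < d → (∀ n → ∃ λ m → a n + d ≤ a m) →
              ∀ x → ∃ λ n → x < a n
  unbounded a {d} 0<d step x with em {∃ λ n → x < a n}
  ... | yes p = p
  ... | no ¬p = contradiction (least (s - d) λ _ (n , y≈) → ≤-respˡ-≈ (sym y≈) (below n)) (λ p → ≤⇒≯ p s-d<s)
    where
    bounded : ∃ (IsSupremum (Range a))
    bounded = supremum (Range a) (_ , 0 , refl)
      (x , λ _ (n , y≈) → ≤-respˡ-≈ (sym y≈) (≮⇒≥ λ x<an → ¬p (n , x<an)))
    s = proj₁ bounded
    least = proj₂ (proj₂ bounded)
    below : ∀ n → a n ≤ s - d
    below n with step n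
    ... | m , an+d≤am =
      ≤-by (solve 3 (λ s d a → s :- d :- a := s :- (a :+ d)) refl s d (a n))
           (x≤y⇒0≤y-x (≤-trans an+d≤am (proj₁ (proj₂ bounded) _ (m , refl))))
    s-d<s : s - d < s
    s-d<s = <-by (solve 2 (λ s d → s :- (s :- d) := d) refl s d) 0<d

  archimedean : ∀ x → ∃ λ n → x < fromℕ n
  archimedean = unbounded fromℕ 0<1 λ n → suc n , inj₂ (+-comm (fromℕ n) 1#)

  fromℕ-≤-suc : ∀ n → fromℕ n ≤ fromℕ (suc n)
  fromℕ-≤-suc n = ≤-by (solve 2 (λ x y → x :+ y :- y := x) refl 1# (fromℕ n)) (inj₁ 0<1)

  fromℕ-mono-≤ : ∀ {m n} → m ℕ.≤ n → fromℕ m ≤ fromℕ n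
  fromℕ-mono-≤ {n = zero}  z≤n       = ≤-refl
  fromℕ-mono-≤ {n = suc n} z≤n       = inj₁ (0<fromℕ-suc n)
  fromℕ-mono-≤             (s≤s m≤n) = +-mono-≤ ≤-refl (fromℕ-mono-≤ m≤n)

  1≤fromℕ-suc : ∀ n → 1# ≤ fromℕ (suc n)
  1≤fromℕ-suc n = ≤-respˡ-≈ (+-identityʳ 1#) (fromℕ-mono-≤ {1} {suc n} (s≤s z≤n))

  1/fromℕ-small : ∀ {δ} → 0# < δ → ∃ λ M → ∀ n → M ℕ.≤ n → 1/ fromℕ (suc n) < δ
  1/fromℕ-small {δ} 0<δ with archimedean (1/ δ)
  ... | M , 1/δ<M = M , λ n M≤n →
    let 0<N = 0<fromℕ-suc n
        1/δ<N = <-≤-trans 1/δ<M (≤-trans (fromℕ-mono-≤ M≤n) (fromℕ-≤-suc n))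
        1/N = 1/ fromℕ (suc n)
    -- Both sides of `1/δ<N` are multiplied by `δ * 1/N`.
    in <-respˡ-≈ (trans (solve 3 (λ d r h → d :* h :* r := h :* (r :* d)) refl δ (1/ δ) 1/N)
                        (trans (*-congˡ (1/x*x≈1 0<δ)) (*-identityʳ 1/N)))
         (<-respʳ-≈ (trans (*-assoc δ 1/N _) (trans (*-congˡ (1/x*x≈1 0<N)) (*-identityʳ δ)))
         (*-monoˡ-< (*-pos 0<δ (0<1/x 0<N)) 1/δ<N))

  -- The logarithm.

  lowerSum : ∀ {a b} → Partition a b → Carrier
  lowerSum P = riemannSum 1/_ P (rightTags P)

  IsSupremum-resp-≈ : ∀ {S : Carrier → Set} {s t} → s ≈ t → IsSupremum S s → IsSupremum S t
  IsSupremum-resp-≈ s≈t (upper , least) =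
    (λ x x∈S → ≤-respʳ-≈ s≈t (upper x x∈S)) , (λ u up → ≤-respˡ-≈ s≈t (least u up))

  supremum-degenerate : ∀ {a b s} → 0# < a → a ≈ b → IsSupremum (LowerSum1/t a b) s → s ≈ 0#
  supremum-degenerate {a} {b} {s} 0<a a≈b (upper , least) = ≤-antisym
    (least 0# λ x (P , x≈) → ≤-respˡ-≈ (sym x≈) (≤-respʳ-≈ (vanish (1/ a)) (lowerSum-bound 0<a P)))
    (upper 0# ([] ▹ inj₂ a≈b , sym (trans (+-identityˡ _) (vanish (1/ b)))))
    where
    vanish : ∀ z → z * (b - a) ≈ 0#
    vanish z = trans (*-congˡ (trans (+-congˡ (-‿cong a≈b)) (-‿inverseʳ b))) (zeroʳ z)

  -- The case split in `log` may take its second branch when `x ≈ 1#`. Both integrals are then over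
  -- degenerate intervals and vanish, so the sign does not matter.
  log-isSupremum : ∀ x 0<x → 1# ≤ x → IsSupremum (LowerSum1/t 1# x) (log (x , 0<x))
  log-isSupremum x 0<x 1≤x with ≤-total 1# x
  ... | inj₁ 1≤x′ = proj₂ (∫1/t-supremum 1# x 0<1 1≤x′)
  ... | inj₂ x≤1  = IsSupremum-resp-≈
    (trans (supremum-degenerate 0<1 1≈x (proj₂ sup))
      (trans (solve 0 (con (+ 0) := :- con (+ 0)) refl)
        (-‿cong (sym (supremum-degenerate 0<x (sym 1≈x) (proj₂ (∫1/t-supremum x 1# 0<x x≤1)))))))
    (proj₂ sup)
    where
    1≈x = ≤-antisym 1≤x x≤1
    sup = ∫1/t-supremum 1# x 0<1 1≤x

  -- Appending `[a , b]` to a partition of `[1 , a]` adds exactly `d` to its lower sum, so `t - d`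
  -- bounds all lower sums over `[1 , a]`.
  log-increment-≥ : ∀ {a b s t} → a ≤ b →
    IsSupremum (LowerSum1/t 1# a) s → IsSupremum (LowerSum1/t 1# b) t →
    s + 1/ b * (b - a) ≤ t
  log-increment-≥ {a} {b} {s} {t} a≤b (_ , least) (upper , _) =
    ≤-by (solve 3 (λ s d t → t :- (s :+ d) := t :- d :- s) refl s d t)
      (x≤y⇒0≤y-x (least (t - d) λ x (P , x≈) → ≤-respˡ-≈ (sym x≈)
        (≤-by (solve 3 (λ p d t → t :- d :- p := t :- (p :+ d)) refl (lowerSum P) d t)
          (x≤y⇒0≤y-x (upper _ (P ▹ a≤b , refl))))))
    where
    d = 1/ b * (b - a)

  -- A lower sum over `[1 , b]` is cut at `a`: the part before `a` contributes at most `s`, and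
  -- beyond `a` the heights are at most `1/ a`.
  log-increment-≤ : ∀ {a b s t} → 1# ≤ a → a ≤ b →
    IsSupremum (LowerSum1/t 1# a) s → IsSupremum (LowerSum1/t 1# b) t →
    t ≤ s + 1/ a * (b - a)
  log-increment-≤ {a} {b} {s} 1≤a a≤b (upper , _) (_ , least) =
    least _ λ x (P , x≈) → ≤-respˡ-≈ (sym x≈) (bound P a≤b)
    where
    0<a = <-≤-trans 0<1 1≤a
    -- The endpoint is generalised to any `y` at or beyond `a`, so that the induction can drop the
    -- last interval.
    bound : ∀ {y} (P : Partition 1# y) → a ≤ y → lowerSum P ≤ s + 1/ a * (y - a)
    bound [] a≤1 = ≤-by
      (solve 3 (λ s r a → s :+ r :* (con (+ 1) :- a) :- con (+ 0) :=
                          s :- (con (+ 0) :+ r :* (a :- con (+ 1)))) refl s (1/ a) a)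
      (x≤y⇒0≤y-x (upper _ ([] ▹ 1≤a , refl)))
    bound (_▹_ {x} {y} P x≤y) a≤y with ≤⊎> x a
    -- The last interval straddles `a`. Raising its height from `1/ y` to `1/ a` allows the cut, and
    -- `P ▹ x≤a` is a partition ending at `a`.
    ... | inj₁ x≤a = ≤-by
      (solve 7 (λ s p r q a x y → s :+ r :* (y :- a) :- (p :+ q :* (y :- x)) :=
                 (s :- (p :+ r :* (a :- x))) :+ (r :- q) :* (y :- x)) refl
        s (lowerSum P) (1/ a) (1/ y) a x y)
      (0≤+ (x≤y⇒0≤y-x (upper _ (P ▹ x≤a , refl)))
           (0≤* (x≤y⇒0≤y-x (1/-anti-≤ 0<a (0<-≤-trans 0<a a≤y) a≤y)) (x≤y⇒0≤y-x x≤y)))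
    ... | inj₂ a<x = ≤-by
      (solve 7 (λ s p r q a x y → s :+ r :* (y :- a) :- (p :+ q :* (y :- x)) :=
                 (s :+ r :* (x :- a) :- p) :+ (r :- q) :* (y :- x)) refl
        s (lowerSum P) (1/ a) (1/ y) a x y)
      (0≤+ (x≤y⇒0≤y-x (bound P (inj₁ a<x)))
           (0≤* (x≤y⇒0≤y-x (1/-anti-≤ 0<a (0<-≤-trans 0<a a≤y) a≤y)) (x≤y⇒0≤y-x x≤y)))

  -- From here on an index `n` stands for the positive integer `suc n`, which is visibly nonzero.
  log-suc : ℕ → Carrier
  log-suc n = log (fromℕ⁺ (suc n))

  log-suc-isSupremum : ∀ n → IsSupremum (LowerSum1/t 1# (fromℕ (suc n))) (log-suc n)
  log-suc-isSupremum n = log-isSupremum _ (0<fromℕ-suc n) (1≤fromℕ-suc n)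

  log-suc-mono-≤ : ∀ {m n} → m ℕ.≤ n → log-suc m ≤ log-suc n
  log-suc-mono-≤ {m} {n} m≤n = ≤-trans
    (≤-by (solve 2 (λ s d → s :+ d :- s := d) refl (log-suc m) d)
      (0≤* (inj₁ (0<1/x (0<fromℕ-suc n))) (x≤y⇒0≤y-x sm≤sn)))
    (log-increment-≥ sm≤sn (log-suc-isSupremum m) (log-suc-isSupremum n))
    where
    sm≤sn = fromℕ-mono-≤ (s≤s m≤n)
    d = 1/ fromℕ (suc n) * (fromℕ (suc n) - fromℕ (suc m))

  -- Doubling the argument increases the logarithm by at least 1/2.
  log-suc-unbounded : ∀ x → ∃ λ n → x < log-suc n
  log-suc-unbounded = unbounded log-suc (0<1/x 0<2) λ n →
    -- This index stands for `2 (n + 1)`, the double of the integer with index `n`.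
    suc (n ℕ.+ n) , ≤-respˡ-≈ (+-congˡ (half n))
      (log-increment-≥ (fromℕ-mono-≤ (s≤s (ℕ.m≤n⇒m≤1+n (ℕ.m≤m+n n n))))
        (log-suc-isSupremum n) (log-suc-isSupremum (suc (n ℕ.+ n))))
    where
    2# = 1# + 1#
    0<2 : 0# < 2#
    0<2 = 0<+0≤ 0<1 (inj₁ 0<1)
    half : ∀ n → 1/ fromℕ (suc (suc (n ℕ.+ n))) * (fromℕ (suc (suc (n ℕ.+ n))) - fromℕ (suc n)) ≈ 1/ 2#
    half n = begin
      r * (M - N)             ≈⟨ *-congˡ (+-congʳ M≈) ⟩
      r * (2# * N - N)        ≈⟨ solve 2 (λ r n → r :* ((con (+ 1) :+ con (+ 1)) :* n :- n) := r :* n) refl r N ⟩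
      r * N                   ≈⟨ *-identityˡ _ ⟨
      1# * (r * N)            ≈⟨ *-congʳ (1/x*x≈1 0<2) ⟨
      1/ 2# * 2# * (r * N)
        ≈⟨ solve 4 (λ h t r n → h :* t :* (r :* n) := h :* (r :* (t :* n))) refl (1/ 2#) 2# r N ⟩
      1/ 2# * (r * (2# * N))  ≈⟨ *-congˡ (*-congˡ M≈) ⟨
      1/ 2# * (r * M)         ≈⟨ *-congˡ (1/x*x≈1 (0<fromℕ-suc (suc (n ℕ.+ n)))) ⟩
      1/ 2# * 1#              ≈⟨ *-identityʳ _ ⟩
      1/ 2#                   ∎
      where
      open SetoidReasoning setoid
      N = fromℕ (suc n)
      M = fromℕ (suc (suc (n ℕ.+ n)))
      r = 1/ M
      M≈ : M ≈ 2# * N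
      M≈ = trans (+-congˡ (+-congˡ (×-homo-+ 1# n n)))
        (solve 1 (λ n → con (+ 1) :+ (con (+ 1) :+ (n :+ n)) :=
                        (con (+ 1) :+ con (+ 1)) :* (con (+ 1) :+ n)) refl (fromℕ n))

  -- Finite sums.

  -- A summand defined on all of `ℕ` lets inductions peel off the last term, while the sum still
  -- unfolds to the form in the theorem.
  Σ< : (ℕ → Carrier) → ℕ → Carrier
  Σ< F n = sum (λ (i : Fin n) → F (toℕ i))

  Σ<-suc : ∀ F n → Σ< F (suc n) ≈ Σ< F n + F n
  Σ<-suc F zero    = +-comm (F 0) 0#
  Σ<-suc F (suc n) = trans (+-congˡ (Σ<-suc (λ i → F (suc i)) n)) (sym (+-assoc _ _ _))

  Σ<-cong : ∀ {F G} n → (∀ i → F i ≈ G i) → Σ< F n ≈ Σ< G n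
  Σ<-cong zero    F≈G = refl
  Σ<-cong (suc n) F≈G = +-cong (F≈G 0) (Σ<-cong n (λ i → F≈G (suc i)))

  Σ<-weighted-≤ : ∀ (F l : ℕ → Carrier) {L} n → (∀ i → i ℕ.< n → 0# ≤ F i) → (∀ i → i ℕ.< n → l i ≤ L) →
                  Σ< (λ i → F i * l i) n ≤ L * Σ< F n
  Σ<-weighted-≤ F l {L} zero _ _ = inj₂ (sym (zeroʳ L))
  Σ<-weighted-≤ F l {L} (suc n) 0≤F l≤L = ≤-by
    (trans (+-cong (*-congˡ (Σ<-suc F n)) (-‿cong (Σ<-suc (λ i → F i * l i) n)))
      (solve 5 (λ L S T f l → L :* (S :+ f) :- (T :+ f :* l) := (L :* S :- T) :+ f :* (L :- l)) refl
        L (Σ< F n) (Σ< (λ i → F i * l i) n) (F n) (l n)))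
    (0≤+ (x≤y⇒0≤y-x (Σ<-weighted-≤ F l n (λ i i<n → 0≤F i (ℕ.m<n⇒m<1+n i<n))
                                          (λ i i<n → l≤L i (ℕ.m<n⇒m<1+n i<n))))
         (0≤* (0≤F n ℕ.≤-refl) (x≤y⇒0≤y-x (l≤L n ℕ.≤-refl))))

  -- The two sides are the sums of `F i * (L - l i)` and of `M * (L - l i)`, which compare term by
  -- term because `L - l i` is nonnegative. For logarithms this reduces the cost of replacing `l i`
  -- by `L` to `log-deficit`.
  Σ<-weighted-deficit : ∀ (F l : ℕ → Carrier) {L M} n → (∀ i → i ℕ.< n → F i ≤ M) → (∀ i → i ℕ.< n → l i ≤ L) →
                        L * Σ< F n - Σ< (λ i → F i * l i) n ≤ M * (L * fromℕ n - Σ< l n)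
  Σ<-weighted-deficit F l {L} {M} zero _ _ =
    inj₂ (solve 2 (λ L M → L :* con (+ 0) :- con (+ 0) := M :* (L :* con (+ 0) :- con (+ 0))) refl L M)
  Σ<-weighted-deficit F l {L} {M} (suc n) F≤M l≤L = ≤-by
    (trans (+-cong (*-congˡ (+-congˡ (-‿cong (Σ<-suc l n))))
                   (-‿cong (+-cong (*-congˡ (Σ<-suc F n)) (-‿cong (Σ<-suc (λ i → F i * l i) n)))))
      (solve 8 (λ L M S T U N f l →
          M :* (L :* (con (+ 1) :+ N) :- (U :+ l)) :- (L :* (S :+ f) :- (T :+ f :* l)) :=
          (M :* (L :* N :- U) :- (L :* S :- T)) :+ (M :- f) :* (L :- l)) refl
        L M (Σ< F n) (Σ< (λ i → F i * l i) n) (Σ< l n) (fromℕ n) (F n) (l n)))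
    (0≤+ (x≤y⇒0≤y-x (Σ<-weighted-deficit F l n (λ i i<n → F≤M i (ℕ.m<n⇒m<1+n i<n))
                                                (λ i i<n → l≤L i (ℕ.m<n⇒m<1+n i<n))))
         (0≤* (x≤y⇒0≤y-x (F≤M n ℕ.≤-refl)) (x≤y⇒0≤y-x (l≤L n ℕ.≤-refl))))

  -- In the induction step, N (log (N + 1) - log N) ≤ 1.
  log-deficit : ∀ n → log-suc n * fromℕ (suc n) - Σ< log-suc (suc n) ≤ fromℕ (suc n)
  log-deficit zero = ≤-by
    (solve 1 (λ l → con (+ 1) :+ con (+ 0) :-
                    (l :* (con (+ 1) :+ con (+ 0)) :- (l :+ con (+ 0))) := con (+ 1)) refl (log-suc 0))
    (inj₁ 0<1)
  log-deficit (suc n) = ≤-by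
    (trans (+-congˡ (-‿cong (+-congˡ (-‿cong (Σ<-suc log-suc (suc n))))))
      (solve 4 (λ N l k S → con (+ 1) :+ N :- (k :* (con (+ 1) :+ N) :- (S :+ k)) :=
                 (N :- (l :* N :- S)) :+ (con (+ 1) :- (k :- l) :* N)) refl
        N (log-suc n) (log-suc (suc n)) (Σ< log-suc (suc n))))
    (0≤+ (x≤y⇒0≤y-x (log-deficit n))
         (x≤y⇒0≤y-x (≤-respʳ-≈ (1/x*x≈1 0<N) (*-monoʳ-≤ (inj₁ 0<N) increment))))
    where
    N = fromℕ (suc n)
    0<N = 0<fromℕ-suc n
    r = 1/ N
    increment : log-suc (suc n) - log-suc n ≤ r
    increment = ≤-by
      (trans (+-congʳ (sym (*-identityʳ r)))
        (solve 4 (λ r N l k → r :* con (+ 1) :- (k :- l) := l :+ r :* (con (+ 1) :+ N :- N) :- k) refl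
          r N (log-suc n) (log-suc (suc n))))
      (x≤y⇒0≤y-x (log-increment-≤ (1≤fromℕ-suc n) (fromℕ-≤-suc (suc n))
        (log-suc-isSupremum n) (log-suc-isSupremum (suc n))))

  -- Riemann sums over uniform partitions.

  uniform : ∀ {h} → 0# ≤ h → ∀ n → Partition 0# (n · h)
  uniform 0≤h zero    = []
  uniform {h} 0≤h (suc n) =
    uniform 0≤h n ▹ ≤-by (solve 2 (λ h x → h :+ x :- x := h) refl h (n · h)) 0≤h

  uniform-mesh : ∀ {h δ} (0≤h : 0# ≤ h) → h < δ → ∀ n → MeshBelow δ (uniform 0≤h n)
  uniform-mesh 0≤h h<δ zero    = tt
  uniform-mesh {h} 0≤h h<δ (suc n) =
    uniform-mesh 0≤h h<δ n , <-respˡ-≈ (solve 2 (λ h x → h := h :+ x :- x) refl h (n · h)) h<δ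

  uniform-riemannSum : ∀ g {h} (0≤h : 0# ≤ h) n →
    riemannSum g (uniform 0≤h n) (rightTags (uniform 0≤h n)) ≈ Σ< (λ i → g (suc i · h)) n * h
  uniform-riemannSum g {h} 0≤h zero    = sym (zeroˡ h)
  uniform-riemannSum g {h} 0≤h (suc n) = trans
    (+-congʳ (uniform-riemannSum g 0≤h n))
    (trans (solve 4 (λ S G h x → S :* h :+ G :* (h :+ x :- x) := (S :+ G) :* h) refl
             (Σ< (λ i → g (suc i · h)) n) (g (suc n · h)) h (n · h))
      (*-congʳ (sym (Σ<-suc (λ i → g (suc i · h)) n))))

  step : ℕ → Carrier
  step n = 1/ fromℕ (suc n)

  0<step : ∀ n → 0# < step n
  0<step n = 0<1/x (0<fromℕ-suc n)

  ·step : ∀ m n → m · step n ≈ fromℕ m * step n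
  ·step m n = trans (×-congʳ m (sym (*-identityˡ (step n)))) (sym (×-assoc-* m 1# (step n)))

  suc·step≈1 : ∀ n → suc n · step n ≈ 1#
  suc·step≈1 n = trans (·step (suc n) n) (x*1/x≈1 (0<⇒≉0 (0<fromℕ-suc n)))

  -- The uniform partition ends at suc n · step n, which is only ≈ 1#: a
  -- degenerate last interval moves the endpoint.
  unitPartition : ℕ → Partition 0# 1#
  unitPartition n = uniform (inj₁ (0<step n)) (suc n) ▹ inj₂ (suc·step≈1 n)

  unitPartition-mesh : ∀ {δ} n → step n < δ → MeshBelow δ (unitPartition n)
  unitPartition-mesh n step<δ = uniform-mesh (inj₁ (0<step n)) step<δ (suc n) ,
    <-respˡ-≈ (trans (sym (-‿inverseʳ 1#)) (+-congˡ (-‿cong (sym (suc·step≈1 n)))))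
      (<-trans (0<step n) step<δ)

  riemannSum-degenerate : ∀ g {x y} (P : Partition 0# x) τ (x≈y : x ≈ y) t →
    riemannSum g (P ▹ inj₂ x≈y) (τ , t) ≈ riemannSum g P τ
  riemannSum-degenerate g {x} {y} P τ x≈y t = trans
    (+-congˡ (trans (*-congˡ (trans (+-congˡ (-‿cong x≈y)) (-‿inverseʳ y))) (zeroʳ _)))
    (+-identityʳ _)

  -- Integrals of positive functions: boundedness and positivity.

  module PositiveIntegrand (g : Carrier → Carrier) (0<g : ∀ {t} → 0# < t → 0# < g t)
                           (c : Carrier) (integral : IsRiemannIntegral g 0# 1# c) where

    -- The tags stay free: convergence uses right endpoints, while boundedness and positivity of the
    -- integral use tags adapted to `g`.
    fine-sums : ∀ {η} → 0# < η → ∃ λ M → ∀ n → M ℕ.≤ n →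
      ∀ τ → ∣ riemannSum g (unitPartition n) τ - c ∣ < η
    fine-sums 0<η =
      let δ , 0<δ , close = integral _ 0<η
          M , small = 1/fromℕ-small 0<δ
      in M , λ n M≤n τ → close (unitPartition n) τ (unitPartition-mesh n (small n M≤n))

    uniform-sums-converge : ∀ {η} → 0# < η → ∃ λ M → ∀ n → M ℕ.≤ n →
      ∣ Σ< (λ i → g (suc i · step n)) (suc n) * step n - c ∣ < η
    uniform-sums-converge 0<η =
      let M , close = fine-sums 0<η
      in M , λ n M≤n →
      let P = uniform (inj₁ (0<step n)) (suc n)
          p = close n M≤n (rightTags (unitPartition n))
          S≈ = +-congʳ (trans (riemannSum-degenerate g P (rightTags P) (suc·step≈1 n)
                                (1# , inj₂ (suc·step≈1 n) , ≤-refl))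
                              (uniform-riemannSum g (inj₁ (0<step n)) (suc n)))
      -- Since `∣_∣` is defined by cases, the equality `S≈` is carried through the two signed
      -- bounds.
      in x<ε∧-x<ε⇒∣x∣<ε (<-respˡ-≈ S≈ (∣x∣<ε⇒x<ε p)) (<-respˡ-≈ (-‿cong S≈) (∣x∣<ε⇒-x<ε p))

    -- Right tags avoid the uncontrolled value of `g` at 0: a tag ending a proper interval is
    -- positive, and a degenerate interval contributes nothing.
    rightTerm-nonneg : ∀ {x y} → 0# ≤ x → x ≤ y → 0# ≤ g y * (y - x)
    rightTerm-nonneg {x} {y} 0≤x (inj₁ x<y) =
      inj₁ (*-pos (0<g (≤-<-trans 0≤x x<y)) (x<y⇒0<y-x x<y))
    rightTerm-nonneg {x} {y} 0≤x (inj₂ x≈y) =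
      inj₂ (sym (trans (*-congˡ (trans (+-congˡ (-‿cong x≈y)) (-‿inverseʳ y))) (zeroʳ (g y))))

    rightSum-nonneg : ∀ {b} (P : Partition 0# b) → 0# ≤ riemannSum g P (rightTags P)
    rightSum-nonneg []        = ≤-refl
    rightSum-nonneg (P ▹ x≤y) = 0≤+ (rightSum-nonneg P) (rightTerm-nonneg (a≤end P) x≤y)

    -- The interval containing `t` is tagged with `t` and all others at their right endpoints, whose
    -- terms are nonnegative.
    tag-at : ∀ {h} (0≤h : 0# ≤ h) {t} n → 0# < t → t ≤ n · h →
      ∃ λ τ → g t * h ≤ riemannSum g (uniform 0≤h n) τ
    tag-at 0≤h zero 0<t t≤0 = contradiction 0<t (≤⇒≯ t≤0)
    tag-at {h} 0≤h {t} (suc n) 0<t t≤ with ≤⊎> t (n · h)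
    ... | inj₁ t≤nh with tag-at 0≤h n 0<t t≤nh
    ... | τ , below = (τ , proj₂ (rightTags (uniform 0≤h (suc n)))) ,
      ≤-respˡ-≈ (+-identityʳ _) (+-mono-≤ below (rightTerm-nonneg (a≤end (uniform 0≤h n))
        (≤-by (solve 2 (λ h x → h :+ x :- x := h) refl h (n · h)) 0≤h)))
    tag-at {h} 0≤h {t} (suc n) 0<t t≤ | inj₂ nh<t =
      (rightTags (uniform 0≤h n) , t , inj₁ nh<t , t≤) ,
      ≤-respˡ-≈ (+-identityˡ _) (+-mono-≤ (rightSum-nonneg (uniform 0≤h n))
        (inj₂ (*-congˡ (solve 2 (λ h x → h := h :+ x :- x) refl h (n · h)))))

    -- By positivity, a single term g t * h of a fine uniform Riemann sum is below
    -- the whole sum, hence below c + 1.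
    bounded : ∃ λ M → ∀ t → 0# < t → t ≤ 1# → g t ≤ M
    bounded = (c + 1#) * fromℕ (suc m) , bound
      where
      fine = fine-sums 0<1
      m = proj₁ fine
      h = step m
      0≤h = inj₁ (0<step m)
      tag : ∃ λ s → suc m · h ≤ s × s ≤ 1#
      tag = 1# , inj₂ (suc·step≈1 m) , ≤-refl
      bound : ∀ t → 0# < t → t ≤ 1# → g t ≤ (c + 1#) * fromℕ (suc m)
      bound t 0<t t≤1 = ≤-respˡ-≈
        (trans (*-assoc _ _ _) (trans (*-congˡ (1/x*x≈1 (0<fromℕ-suc m))) (*-identityʳ _)))
        (*-monoʳ-≤ (inj₁ (0<fromℕ-suc m)) (≤-trans below (≤-by
          (trans (+-congˡ (-‿cong (sym (riemannSum-degenerate g (uniform 0≤h (suc m)) τ (suc·step≈1 m) tag))))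
            (solve 3 (λ c u R → c :+ u :- R := u :- (R :- c)) refl
              c 1# (riemannSum g (unitPartition m) (τ , tag))))
          (inj₁ (x<y⇒0<y-x (∣x∣<ε⇒x<ε (proj₂ fine m ℕ.≤-refl (τ , tag))))))))
        where
        tagging = tag-at 0≤h (suc m) 0<t (≤-respʳ-≈ (sym (suc·step≈1 m)) t≤1)
        τ = proj₁ tagging
        below = proj₂ tagging

    -- Tags with `g` at least `ε` are chosen in each partition interval that overlaps `[x , z]`, and
    -- right endpoints elsewhere. The cut-off `z` varies so that the induction can move it back to a
    -- partition point.
    tag-above : ∀ {x y ε} → 0# < x → 0# < ε →
      (∀ p q → x ≤ p → p < q → q ≤ y → ∃ λ t → p ≤ t × t ≤ q × ε ≤ g t) →
      ∀ {b} (P : Partition 0# b) z → z ≤ y → z ≤ b →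
      ∃ λ τ → ε * (z - x) ≤ riemannSum g P τ
    tag-above {x} {y} {ε} 0<x 0<ε above = go
      where
      trivial : ∀ {b} (P : Partition 0# b) z → z ≤ x → ∃ λ τ → ε * (z - x) ≤ riemannSum g P τ
      trivial P z z≤x = rightTags P , ≤-trans
        (≤-by (solve 3 (λ e z x → con (+ 0) :- e :* (z :- x) := e :* (x :- z)) refl ε z x)
          (0≤* (inj₁ 0<ε) (x≤y⇒0≤y-x z≤x)))
        (rightSum-nonneg P)

      -- Here `[l , z]` is the portion of the partition interval `[u , w]` to be covered by its tag
      -- `t`.
      term : ∀ {t l w u} → 0# < t → ε ≤ g t → u ≤ l → l ≤ w → ∀ {z} → z ≤ w → l ≤ z →
             ε * (z - l) ≤ g t * (w - u)
      term {t} {l} {w} {u} 0<t ε≤gt u≤l l≤w {z} z≤w l≤z = ≤-trans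
        (*-monoʳ-≤ (x≤y⇒0≤y-x l≤z) ε≤gt)
        (*-monoˡ-≤ (inj₁ (0<g 0<t))
          (≤-by (solve 4 (λ w u z l → w :- u :- (z :- l) := (w :- z) :+ (l :- u)) refl w u z l)
            (0≤+ (x≤y⇒0≤y-x z≤w) (x≤y⇒0≤y-x u≤l))))

      go : ∀ {b} (P : Partition 0# b) z → z ≤ y → z ≤ b → ∃ λ τ → ε * (z - x) ≤ riemannSum g P τ
      go [] z _ z≤0 = trivial [] z (≤-trans z≤0 (inj₁ 0<x))
      go P@(_▹_ {u} {w} Q u≤w) z z≤y z≤w with ≤⊎> z x | ≤⊎> z u | ≤⊎> u x
      ... | inj₁ z≤x | _ | _ = trivial P z z≤x
      ... | inj₂ _ | inj₁ z≤u | _ with go Q z z≤y z≤u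
      ... | τ , below = (τ , proj₂ (rightTags P)) ,
        ≤-respˡ-≈ (+-identityʳ _) (+-mono-≤ below (rightTerm-nonneg (a≤end Q) u≤w))
      -- The last interval covers all of `[x , z]`, so one tag suffices.
      go P@(_▹_ {u} {w} Q u≤w) z z≤y z≤w | inj₂ x<z | inj₂ u<z | inj₁ u≤x
        with above x z ≤-refl x<z z≤y
      ... | t , x≤t , t≤z , ε≤gt = (rightTags Q , t , ≤-trans u≤x x≤t , ≤-trans t≤z z≤w) ,
        ≤-respˡ-≈ (+-identityˡ _) (+-mono-≤ (rightSum-nonneg Q)
          (term (<-≤-trans 0<x x≤t) ε≤gt u≤x (≤-trans (inj₁ x<z) z≤w) z≤w (inj₁ x<z)))
      -- `[x , z]` is split at `u`: the recursion covers `[x , u]` and one new tag covers `[u , z]`.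
      go P@(_▹_ {u} {w} Q u≤w) z z≤y z≤w | inj₂ x<z | inj₂ u<z | inj₂ x<u
        with above u z (inj₁ x<u) u<z z≤y | go Q u (≤-trans (inj₁ u<z) z≤y) ≤-refl
      ... | t , u≤t , t≤z , ε≤gt | τ , below = (τ , t , u≤t , ≤-trans t≤z z≤w) ,
        ≤-respˡ-≈ (solve 4 (λ e u x z → e :* (u :- x) :+ e :* (z :- u) := e :* (z :- x)) refl ε u x z)
          (+-mono-≤ below (term (<-≤-trans 0<x (≤-trans (inj₁ x<u) u≤t)) ε≤gt ≤-refl u≤w z≤w (inj₁ u<z)))

    record Interval : Set where
      field
        lo hi : Carrier
        0<lo  : 0# < lo
        lo<hi : lo < hi
        hi≤1  : hi ≤ 1#

    open Interval

    _⊑_ : Interval → Interval → Set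
    J ⊑ I = lo I ≤ lo J × hi J ≤ hi I

    Below : Carrier → Interval → Set
    Below ε I = ∀ t → lo I ≤ t → t ≤ hi I → g t < ε

    -- If g ≥ ε somewhere in every subinterval of I, then suitable tags make all
    -- fine Riemann sums at least ε times the length of I.
    shrink : ¬ 0# < c → ∀ {ε} → 0# < ε → (I : Interval) → ∃ λ J → J ⊑ I × Below ε J
    shrink c≯0 {ε} 0<ε I with em {∃ λ J → J ⊑ I × Below ε J}
    ... | yes p = p
    ... | no ¬p = contradiction 0<c c≯0
      where
      above : ∀ p q → lo I ≤ p → p < q → q ≤ hi I → ∃ λ t → p ≤ t × t ≤ q × ε ≤ g t
      above p q lo≤p p<q q≤hi with em {∃ λ t → p ≤ t × t ≤ q × ε ≤ g t}
      ... | yes found = found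
      ... | no ¬found = contradiction
        ( record { lo = p ; hi = q ; 0<lo = <-≤-trans (0<lo I) lo≤p ; lo<hi = p<q ; hi≤1 = ≤-trans q≤hi (hi≤1 I) }
        , (lo≤p , q≤hi) , below ) ¬p
        where
        below : ∀ t → p ≤ t → t ≤ q → g t < ε
        below t p≤t t≤q with ≤⊎> ε (g t)
        ... | inj₁ ε≤gt = contradiction (t , p≤t , t≤q , ε≤gt) ¬found
        ... | inj₂ gt<ε = gt<ε
      d = ε * (hi I - lo I)
      0<d : 0# < d
      0<d = *-pos 0<ε (x<y⇒0<y-x (lo<hi I))
      0<c : 0# < c
      -- A Riemann sum `R` with `d ≤ R` and `R - c < d` forces `c` to be positive.
      0<c =
        let n , close = fine-sums 0<d
            τ , d≤R = tag-above (0<lo I) 0<ε above (unitPartition n) (hi I) ≤-refl (hi≤1 I)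
        in <-respʳ-≈
          (solve 3 (λ c d R → (d :- (R :- c)) :+ (R :- d) := c) refl c d (riemannSum g (unitPartition n) τ))
          (0<+0≤ (x<y⇒0<y-x (∣x∣<ε⇒x<ε (close n ℕ.≤-refl τ))) (x≤y⇒0≤y-x d≤R))

    integral-positive : 0# < c
    integral-positive with em {0# < c}
    ... | yes 0<c = 0<c
    ... | no c≯0 = contradiction
      (<-trans step<g (g<step m)) (<-irrefl refl)
      where
      start : Interval
      -- The nest starts from `[1/2 , 1]`, away from 0, so that its common point is positive.
      start = record
        { lo = step 1 ; hi = 1# ; 0<lo = 0<step 1 ; hi≤1 = ≤-refl
        ; lo<hi = <-by (trans (+-congʳ (sym (suc·step≈1 1)))
                    (solve 1 (λ h → h :+ (h :+ con (+ 0)) :- h := h) refl (step 1))) (0<step 1) }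
      nest : ℕ → Interval
      nest zero    = start
      nest (suc n) = proj₁ (shrink c≯0 (0<step n) (nest n))
      nested : ∀ k n → nest (k ℕ.+ n) ⊑ nest n
      nested zero    n = ≤-refl , ≤-refl
      nested (suc k) n with nested k n | proj₁ (proj₂ (shrink c≯0 (0<step (k ℕ.+ n)) (nest (k ℕ.+ n))))
      ... | lo≤ , hi≤ | lo≤′ , hi≤′ = ≤-trans lo≤ lo≤′ , ≤-trans hi≤′ hi≤
      lo≤hi : ∀ m n → lo (nest m) ≤ hi (nest n)
      lo≤hi m n = ≤-trans (proj₁ (nested n m)) (≤-trans (inj₁ (lo<hi (nest (n ℕ.+ m))))
        (≡.subst (λ k → hi (nest k) ≤ hi (nest n)) (ℕ.+-comm m n) (proj₂ (nested m n))))
      -- Every right endpoint bounds every left endpoint, so the supremum of the left endpoints lies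
      -- in all the intervals.
      point = supremum (Range (λ n → lo (nest n))) (_ , 0 , refl)
        (hi (nest 0) , λ _ (n , x≈) → ≤-respˡ-≈ (sym x≈) (lo≤hi n 0))
      s = proj₁ point
      lo≤s : ∀ n → lo (nest n) ≤ s
      lo≤s n = proj₁ (proj₂ point) _ (n , refl)
      s≤hi : ∀ n → s ≤ hi (nest n)
      s≤hi n = proj₂ (proj₂ point) _ λ _ (m , x≈) → ≤-respˡ-≈ (sym x≈) (lo≤hi m n)
      g<step : ∀ n → g s < step n
      g<step n = proj₂ (proj₂ (shrink c≯0 (0<step n) (nest n))) s (lo≤s (suc n)) (s≤hi (suc n))
      -- Since `s` is positive, so is `g s`, and some `step m` falls below it, against `g<step m`.
      small = 1/fromℕ-small (0<g (<-≤-trans (0<lo (nest 0)) (lo≤s 0)))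
      m = proj₁ small
      step<g : step m < g s
      step<g = proj₂ small m ℕ.≤-refl

  -- From error bounds to the asymptotic ratio.

  -- In the application `q` is a Riemann sum, `ℓ` is the logarithm of `N`, and `S` is the weighted
  -- sum of logarithms. The allowed error `c * ε * N * ℓ` is two portions `η * N * ℓ`, one for
  -- replacing `q` by `c` and one for the deficit `B * N`.
  ratio-close-to-1 : ∀ {c ε η N ℓ q S B} → 0# < c → 0# < N → 0# < ℓ → η + η ≈ c * ε →
    ∣ q - c ∣ < η → S ≤ ℓ * (q * N) → ℓ * (q * N) - S ≤ B * N → B < η * ℓ →
    ∣ S / (c * N * ℓ) - 1# ∣ < ε
  ratio-close-to-1 {c} {ε} {η} {N} {ℓ} {q} {S} {B} 0<c 0<N 0<ℓ 2η≈cε q≈c S≤ ≤S B< = x<ε∧-x<ε⇒∣x∣<ε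
    -- Both signed bounds are proved for `S - D` and then multiplied by `1/ D`.
    (<-respˡ-≈ S-D≈ (<-respʳ-≈ D-cancel (*-monoˡ-< (0<1/x 0<D) upper)))
    (<-respˡ-≈ D-S≈ (<-respʳ-≈ D-cancel (*-monoˡ-< (0<1/x 0<D) lower)))
    where
    D = c * N * ℓ
    0<D : 0# < D
    0<D = *-pos (*-pos 0<c 0<N) 0<ℓ
    r = 1/ D
    rD≈1 = 1/x*x≈1 0<D
    S-D≈ : r * (S - D) ≈ S / D - 1#
    S-D≈ = trans (solve 3 (λ r S D → r :* (S :- D) := S :* r :- r :* D) refl r S D)
                 (+-congˡ (-‿cong rD≈1))
    D-S≈ : r * (D - S) ≈ - (S / D - 1#)
    D-S≈ = trans (solve 3 (λ r S D → r :* (D :- S) := :- (S :* r :- r :* D)) refl r S D)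
                 (-‿cong (+-congˡ (-‿cong rD≈1)))
    D-cancel : r * (D * ε) ≈ ε
    D-cancel = trans (sym (*-assoc r D ε)) (trans (*-congʳ rD≈1) (*-identityˡ ε))
    Dε≈ : D * ε ≈ (η + η) * (N * ℓ)
    Dε≈ = trans (solve 4 (λ c N l e → c :* N :* l :* e := c :* e :* (N :* l)) refl c N ℓ ε)
                (*-congʳ (sym 2η≈cε))
    0<Nℓ = *-pos 0<N 0<ℓ
    0<η : 0# < η
    0<η = ≤-<-trans (0≤∣x∣ (q - c)) q≈c
    upper : S - D < D * ε
    upper = <-by
      (trans (+-congʳ Dε≈)
        (solve 6 (λ c N l n q S → (n :+ n) :* (N :* l) :- (S :- c :* N :* l) :=
                   N :* l :* (n :- (q :- c)) :+ (N :* l :* n :+ (l :* (q :* N) :- S))) refl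
          c N ℓ η q S))
      (0<+0≤ (*-pos 0<Nℓ (x<y⇒0<y-x (∣x∣<ε⇒x<ε q≈c)))
             (0≤+ (inj₁ (*-pos 0<Nℓ 0<η)) (x≤y⇒0≤y-x S≤)))
    lower : D - S < D * ε
    -- One `η` absorbs `c - q`; the other, multiplied by `ℓ`, absorbs `B`.
    lower = <-by
      (trans (+-congʳ Dε≈)
        (solve 7 (λ c N l n q S B → (n :+ n) :* (N :* l) :- (c :* N :* l :- S) :=
                   N :* l :* (n :- (:- (q :- c))) :+
                   (N :* (n :* l :- B) :+ (B :* N :- (l :* (q :* N) :- S)))) refl
          c N ℓ η q S B))
      (0<+0≤ (*-pos 0<Nℓ (x<y⇒0<y-x (∣x∣<ε⇒-x<ε q≈c)))
             (0≤+ (inj₁ (*-pos 0<N (x<y⇒0<y-x B<))) (x≤y⇒0≤y-x ≤S)))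

  -- Weights given by a homogeneous function.

  extendBy-positive : ∀ v (h : ℝ⁺ → Carrier) {t} → (∀ 0<t → 0# < h (t , 0<t)) → 0# < t → 0# < extendBy v h t
  extendBy-positive v h {t} 0<h 0<t with 0# <? t
  ... | yes 0<t′ = 0<h 0<t′
  ... | no  0≮t  = contradiction 0<t 0≮t

  module HomogeneousWeights
    (f : ℝ⁺ → ℝ⁺ → Carrier) (f-cong : f Preserves₂ _≈⁺_ ⟶ _≈⁺_ ⟶ _≈_)
    (0<f : ∀ x y → 0# < f x y) (homogeneous : ∀ k x y → f (k *⁺ x) (k *⁺ y) ≈ f x y)
    (v c : Carrier) (integral : IsRiemannIntegral (extendBy v (λ x → f x 1⁺)) 0# 1# c) where

    g : Carrier → Carrier
    g = extendBy v (λ x → f x 1⁺)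

    weight : ℕ → ℕ → Carrier
    weight n i = f (fromℕ⁺ (suc i)) (fromℕ⁺ (suc n))

    open PositiveIntegrand g (extendBy-positive v (λ x → f x 1⁺) (λ _ → 0<f _ _)) c integral

    -- The arguments are written as `N` times `suc i · step n` and `N` times 1, and homogeneity
    -- cancels the factor `N`.
    weight≈g : ∀ n i → weight n i ≈ g (suc i · step n)
    -- This is the case split inside `extendBy`; the point is positive, so the value `v` never
    -- occurs.
    weight≈g n i with 0# <? suc i · step n
    ... | yes 0<t = trans
      (f-cong (sym (trans (*-congˡ (·step (suc i) n))
                 (trans (solve 3 (λ N I h → N :* (I :* h) := I :* (h :* N)) refl N (fromℕ (suc i)) (step n))
                   (trans (*-congˡ (1/x*x≈1 0<N)) (*-identityʳ (fromℕ (suc i)))))))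
              (sym (*-identityʳ N)))
      (homogeneous (fromℕ⁺ (suc n)) (suc i · step n , 0<t) 1⁺)
      where
      N = fromℕ (suc n)
      0<N = 0<fromℕ-suc n
    ... | no 0≮t = contradiction
      (<-respʳ-≈ (sym (·step (suc i) n)) (*-pos (0<fromℕ-suc i) (0<step n))) 0≮t

    weight≤bound : ∀ n i → i ℕ.< suc n → weight n i ≤ proj₁ bounded
    weight≤bound n i i<N = ≤-respˡ-≈ (sym (weight≈g n i)) (proj₂ bounded _
      (<-respʳ-≈ (sym (·step (suc i) n)) (*-pos (0<fromℕ-suc i) (0<step n)))
      (≤-respˡ-≈ (sym (·step (suc i) n)) (≤-respʳ-≈ (x*1/x≈1 (0<⇒≉0 (0<fromℕ-suc n)))
        (*-monoʳ-≤ (inj₁ (0<step n)) (fromℕ-mono-≤ i<N)))))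

    0<bound : 0# < proj₁ bounded
    0<bound = <-≤-trans (0<f _ _) (weight≤bound 0 0 (s≤s z≤n))

    logSum : ℕ → Carrier
    logSum n = Σ< (λ i → weight n i * log-suc i) (suc n)

    asymptotic : ∀ ε → 0# < ε → ∃ λ M → ∀ n → M ℕ.≤ n →
      ∣ logSum n / (c * fromℕ (suc n) * log-suc n) - 1# ∣ < ε
    asymptotic ε 0<ε =
      let M₁ , close = uniform-sums-converge 0<η
          -- Once the logarithm of `N` exceeds `B` divided by `η`, the deficit `B * N` is below
          -- `η * N * ℓ`.
          M₂ , B/η<log = log-suc-unbounded (1/ η * B)
      in M₁ ℕ.⊔ M₂ , λ n M≤n →
      let N = fromℕ (suc n)
          ℓ = log-suc n
          l≤ℓ = λ i (i<N : i ℕ.< suc n) → log-suc-mono-≤ (ℕ.s≤s⁻¹ i<N)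
          B/η<ℓ = <-≤-trans B/η<log (log-suc-mono-≤ (ℕ.≤-trans (ℕ.m≤n⊔m M₁ M₂) M≤n))
          S≈ : Σ< (weight n) (suc n) ≈ Σ< (λ i → g (suc i · step n)) (suc n) * step n * N
          S≈ = trans (Σ<-cong (suc n) (weight≈g n))
                 (sym (trans (*-assoc _ (step n) N)
                   (trans (*-congˡ (1/x*x≈1 (0<fromℕ-suc n))) (*-identityʳ _))))
      in ratio-close-to-1 integral-positive (0<fromℕ-suc n)
           -- The same threshold makes `ℓ` positive, which excludes `N = 1`.
           (<-trans (*-pos (0<1/x 0<η) 0<bound) B/η<ℓ)
           2η≈cε
           (close n (ℕ.≤-trans (ℕ.m≤m⊔n M₁ M₂) M≤n))
           (≤-respʳ-≈ (*-congˡ S≈)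
             (Σ<-weighted-≤ (weight n) log-suc (suc n) (λ i _ → inj₁ (0<f _ _)) l≤ℓ))
           (≤-respˡ-≈ (+-congʳ (*-congˡ S≈))
             (≤-trans (Σ<-weighted-deficit (weight n) log-suc (suc n) (weight≤bound n) l≤ℓ)
                      (*-monoˡ-≤ (inj₁ 0<bound) (log-deficit n))))
           (<-respˡ-≈ (trans (sym (*-assoc η (1/ η) B))
               (trans (*-congʳ (x*1/x≈1 (0<⇒≉0 0<η))) (*-identityˡ B)))
             (*-monoˡ-< 0<η B/η<ℓ))
      where
      B = proj₁ bounded
      -- `step 1` is one half.
      η = c * ε * step 1
      0<η : 0# < η
      0<η = *-pos (*-pos integral-positive 0<ε) (0<step 1)
      2η≈cε : η + η ≈ c * ε
      2η≈cε = trans (solve 2 (λ x h → x :* h :+ x :* h := x :* (h :+ (h :+ con (+ 0)))) refl (c * ε) (step 1))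
                    (trans (*-congˡ (suc·step≈1 1)) (*-identityʳ (c * ε)))

lemma1p1 : ExcludedMiddle 0ℓ →
    (ℝ : CompleteOrderedField) → let open Real ℝ in
    (f : ℝ⁺ → ℝ⁺ → Carrier) →
    f Preserves₂ _≈⁺_ ⟶ _≈⁺_ ⟶ _≈_ →
    (∀ x y → 0# < f x y) →
    (∀ k x y → f (k *⁺ x) (k *⁺ y) ≈ f x y) →
    (v : Carrier) →
    (integrable : RiemannIntegrable (extendBy v (λ x → f x 1⁺)) 0# 1#) →
    let c = ∫ (extendBy v (λ x → f x 1⁺)) 0# 1# integrable in
    (λ N → sum (λ (i : Fin N) → f (fromℕ⁺ (suc (toℕ i))) (fromℕ⁺ N) * log (fromℕ⁺ (suc (toℕ i)))))
    ∼ (λ N → c * fromℕ N * log (fromℕ⁺ N))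
lemma1p1 em ℝ f f-cong 0<f homogeneous v (c , integral) ε 0<ε =
  let M , close = asymptotic ε 0<ε
  -- The threshold `M` for the index `n` becomes `suc M` for the integer `N = suc n`.
  in suc M , λ { (suc n) (s≤s M≤n) → close n M≤n }
  where
  open RealAnalysis em ℝ
  open HomogeneousWeights f f-cong 0<f homogeneous v c integral
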